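{- Let $X$ and $Y$ be separable metrizable spaces, $X$ nonempty, let $(W_m)_{m\in\omega}$ be a good basis of $X$, and let $f:X\rightarrow Y$ be a function. Then $f$ is recoverable if and only if $f$ is Baire class one.
   Context: $f:X\to Y$ is Baire class one if $f^{ -1}(U)$ is an $F_\sigma$ subset of $X$ for every open $U\subseteq Y$. A basis $(W_m)_{m\in\omega}$ for the topology of $X$ is a good basis if for each open $U\subseteq X$ and each $x\in U$ there is $m_0$ such that for all $m\geq m_0$: if $x\in W_m$ then $W_m\subseteq U$. Let $D=(x_p)_{p\in\omega}$ be a dense sequence in $X$ and $x\in X$. The path to $x$ based on $D$ is the sequence $(s_n[x,D])_{n\in\omega}$ defined by: $s_0[x,D]:=x_0$; $s_{n+1}[x,D]:=s_n[x,D]$ if $x=s_n[x,D]$; otherwise $s_{n+1}[x,D]:=x_p$, where $p$ is the least integer such that there exists $m\in\omega$ with $\{x,x_p\}\subseteq W_m\subseteq X\setminus\{s_0[x,D],\ldots,s_n[x,D]\}$. $f$ is recoverable with respect to $D$ if for each $x\in X$ the sequence $(f(s_n[x,D]))_n$ tends to $f(x)$. $f$ is recoverable if there exists a dense sequence $D$ of $X$ such that $f$ is recoverable with respect to $D$. -}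

module Defs where

open import Axiom.ExcludedMiddle using (ExcludedMiddle)
open import Data.Nat.Base as ℕ using (ℕ; zero; suc)
import Data.Nat.Properties as ℕ
open import Data.Product.Base using (∃-syntax; Σ-syntax; _×_; _,_)
open import Data.Rational.Base as ℚ using (ℚ; 0ℚ; 1ℚ)
import Data.Rational.Properties as ℚ
open import Data.Sum.Base using (inj₁; inj₂)
open import Function.Base using (_∘_)
open import Function.Bundles using (_⇔_)
open import Level using (0ℓ)
open import Relation.Binary.PropositionalEquality
  using (_≡_; _≢_; refl; sym; trans; cong; subst; module ≡-Reasoning)
open import Relation.Nullary using (yes; no)
open import Relation.Unary
  using (Pred; _∈_; _∉_; _⊆_; _≐_; _≬_; _⊢_; _∩_; _∪_; ∁; ⋃; ｛_｝; Satisfiable)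
  renaming (U to Full)

-- Classical (one-sided) Dedekind cuts, x being represented by the set of
-- rationals strictly below it.  Only suitable where excluded middle is
-- available: otherwise these are the lower reals.
record ℝ : Set₁ where
  field
    cut       : Pred ℚ 0ℓ
    inhabited : ∃[ p ] p ∈ cut
    bounded   : ∃[ u ] (∀ {p} → p ∈ cut → p ℚ.< u)
    lower     : ∀ {p q} → p ℚ.< q → q ∈ cut → p ∈ cut
    noMax     : ∀ {p} → p ∈ cut → ∃[ q ] p ℚ.< q × q ∈ cut

open ℝ

infix 4 _≤ᴿ_ _<ᴿ_ _≈ᴿ_
infixl 6 _+ᴿ_

_≤ᴿ_ : ℝ → ℝ → Set
x ≤ᴿ y = cut x ⊆ cut y

_<ᴿ_ : ℝ → ℝ → Set
x <ᴿ y = ∃[ q ] q ∉ cut x × q ∈ cut y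

_≈ᴿ_ : ℝ → ℝ → Set
x ≈ᴿ y = cut x ≐ cut y

private
  p-1<p : ∀ p → p ℚ.- 1ℚ ℚ.< p
  p-1<p p = subst (p ℚ.- 1ℚ ℚ.<_) (ℚ.+-identityʳ p)
              (ℚ.+-monoʳ-< p (ℚ.negative⁻¹ (ℚ.- 1ℚ)))

  [p-b]+b : ∀ p b → (p ℚ.- b) ℚ.+ b ≡ p
  [p-b]+b p b = begin
    (p ℚ.- b) ℚ.+ b      ≡⟨ ℚ.+-assoc p (ℚ.- b) b ⟩
    p ℚ.+ (ℚ.- b ℚ.+ b)  ≡⟨ cong (p ℚ.+_) (ℚ.+-inverseˡ b) ⟩
    p ℚ.+ 0ℚ             ≡⟨ ℚ.+-identityʳ p ⟩
    p                    ∎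
    where open ≡-Reasoning

  [a+b]-b : ∀ a b → (a ℚ.+ b) ℚ.- b ≡ a
  [a+b]-b a b = begin
    (a ℚ.+ b) ℚ.- b      ≡⟨ ℚ.+-assoc a b (ℚ.- b) ⟩
    a ℚ.+ (b ℚ.- b)      ≡⟨ cong (a ℚ.+_) (ℚ.+-inverseʳ b) ⟩
    a ℚ.+ 0ℚ             ≡⟨ ℚ.+-identityʳ a ⟩
    a                    ∎
    where open ≡-Reasoning

fromℚ : ℚ → ℝ
fromℚ r = record
  { cut       = ℚ._< r
  ; inhabited = r ℚ.- 1ℚ , p-1<p r
  ; bounded   = r , λ p<r → p<r
  ; lower     = ℚ.<-trans
  ; noMax     = ℚ.<-dense
  }

0ᴿ : ℝ
0ᴿ = fromℚ 0ℚ

_+ᴿ_ : ℝ → ℝ → ℝ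
x +ᴿ y = record
  { cut       = sumCut
  ; inhabited = sumInhabited
  ; bounded   = sumBounded
  ; lower     = sumLower
  ; noMax     = sumNoMax
  }
  where
  sumCut : Pred ℚ 0ℓ
  sumCut q = ∃[ a ] ∃[ b ] a ∈ cut x × b ∈ cut y × q ≡ a ℚ.+ b

  sumInhabited : ∃[ p ] p ∈ sumCut
  sumInhabited with a , a∈x ← inhabited x | b , b∈y ← inhabited y =
    a ℚ.+ b , a , b , a∈x , b∈y , refl

  sumBounded : ∃[ w ] (∀ {p} → p ∈ sumCut → p ℚ.< w)
  sumBounded with u , x<u ← bounded x | v , y<v ← bounded y =
    u ℚ.+ v , λ (a , b , a∈x , b∈y , p≡a+b) →
      subst (ℚ._< u ℚ.+ v) (sym p≡a+b) (ℚ.+-mono-< (x<u a∈x) (y<v b∈y))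

  sumLower : ∀ {p q} → p ℚ.< q → q ∈ sumCut → p ∈ sumCut
  sumLower {p} p<q (a , b , a∈x , b∈y , refl) =
    p ℚ.- b , b
    , lower x (subst (p ℚ.- b ℚ.<_) ([a+b]-b a b) (ℚ.+-monoˡ-< (ℚ.- b) p<q)) a∈x
    , b∈y , sym ([p-b]+b p b)

  sumNoMax : ∀ {p} → p ∈ sumCut → ∃[ q ] p ℚ.< q × q ∈ sumCut
  sumNoMax (a , b , a∈x , b∈y , refl) with a′ , a<a′ , a′∈x ← noMax x a∈x =
    a′ ℚ.+ b , ℚ.+-monoˡ-< b a<a′ , a′ , b , a′∈x , b∈y , refl

-- Closure under _≐_ is needed since extensionally equal predicates need not
-- be propositionally equal.  The empty set is the union indexed by ⊥.
record Topology (X : Set) : Set₂ where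
  field
    Open      : Pred X 0ℓ → Set₁
    Open-resp : ∀ {U V} → U ≐ V → Open U → Open V
    Open-Full : Open Full
    Open-∩    : ∀ {U V} → Open U → Open V → Open (U ∩ V)
    Open-⋃    : ∀ {I : Set} {U : I → Pred X 0ℓ} → (∀ i → Open (U i)) → Open (⋃ I U)

  Closed : Pred X 0ℓ → Set₁
  Closed C = Open (∁ C)

  Fσ : Pred X 0ℓ → Set₁
  Fσ A = ∃[ C ] (∀ (n : ℕ) → Closed (C n)) × A ≐ ⋃ ℕ C

  Dense : Pred X 0ℓ → Set₁
  Dense A = ∀ {U} → Open U → Satisfiable U → A ≬ U

  Converges : (ℕ → X) → X → Set₁
  Converges s x = ∀ {U} → Open U → x ∈ U → ∃[ N ] ∀ n → N ℕ.≤ n → s n ∈ U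

  IsBasis : (ℕ → Pred X 0ℓ) → Set₁
  IsBasis W = (∀ m → Open (W m)) ×
              (∀ {U} → Open U → ∀ {x} → x ∈ U → ∃[ m ] x ∈ W m × W m ⊆ U)

  IsGoodBasis : (ℕ → Pred X 0ℓ) → Set₁
  IsGoodBasis W = IsBasis W ×
    (∀ {U} → Open U → ∀ {x} → x ∈ U →
       ∃[ m₀ ] ∀ m → m₀ ℕ.≤ m → x ∈ W m → W m ⊆ U)

open Topology

record Metric (X : Set) : Set₁ where
  field
    d        : X → X → ℝ
    nonneg   : ∀ x y → 0ᴿ ≤ᴿ d x y
    identity : ∀ x y → d x y ≈ᴿ 0ᴿ ⇔ x ≡ y
    symm     : ∀ x y → d x y ≈ᴿ d y x
    triangle : ∀ x y z → d x z ≤ᴿ d x y +ᴿ d y z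

  ball : X → ℝ → Pred X 0ℓ
  ball x ε y = d x y <ᴿ ε

  MetricOpen : Pred X 0ℓ → Set₁
  MetricOpen U = ∀ {x} → x ∈ U → ∃[ ε ] 0ᴿ <ᴿ ε × ball x ε ⊆ U

Metrizable : {X : Set} → Topology X → Set₁
Metrizable {X} τ = ∃[ ρ ] ∀ U → Open τ U ⇔ Metric.MetricOpen {X} ρ U

Countable : {X : Set} → Pred X 0ℓ → Set
Countable {X} A = Σ[ g ∈ (X → ℕ) ] ∀ {x y} → x ∈ A → y ∈ A → g x ≡ g y → x ≡ y

Separable : {X : Set} → Topology X → Set₁
Separable τ = ∃[ A ] Countable A × Dense τ A

Range : {X : Set} → (ℕ → X) → Pred X 0ℓ
Range s x = ∃[ n ] x ≡ s n

BaireClassOne : {X Y : Set} → Topology X → Topology Y → (X → Y) → Set₁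
BaireClassOne τX τY f = ∀ {U} → Open τY U → Fσ τX (f ⊢ U)

IsLeast : Pred ℕ 0ℓ → Pred ℕ 0ℓ
IsLeast P p = p ∈ P × (∀ q → q ∈ P → p ℕ.≤ q)

module _ {X : Set} (W : ℕ → Pred X 0ℓ) (D : ℕ → X) (x : X) where

  Initial : (ℕ → X) → ℕ → Pred X 0ℓ
  Initial s n y = ∃[ i ] i ℕ.≤ n × y ≡ s i

  Candidate : (ℕ → X) → ℕ → Pred ℕ 0ℓ
  Candidate s n p = ∃[ m ] (｛ x ｝ ∪ ｛ D p ｝) ⊆ W m × W m ⊆ ∁ (Initial s n)

  -- The recursion defining the path, as a predicate on sequences, because
  -- neither x ≡ s n nor Candidate s n p is decidable without excluded middle
  -- and the least p exists only under hypotheses on W and D.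
  record IsPath (s : ℕ → X) : Set where
    field
      start : s 0 ≡ D 0
      stay  : ∀ n → x ≡ s n → s (suc n) ≡ s n
      move  : ∀ n → x ≢ s n → ∃[ p ] IsLeast (Candidate s n) p × s (suc n) ≡ D p

  open IsPath

  module _ (em : ExcludedMiddle 0ℓ) {s t : ℕ → X} (S : IsPath s) (T : IsPath t) where

    private
      transport : ∀ {s t : ℕ → X} {n p} → (∀ i → i ℕ.≤ n → s i ≡ t i) →
                  Candidate s n p → Candidate t n p
      transport s≗t (m , sub , avoid) = m , sub , λ y∈W (i , i≤n , y≡ti) →
        avoid y∈W (i , i≤n , trans y≡ti (sym (s≗t i i≤n)))

      step : ∀ n → (∀ i → i ℕ.≤ n → s i ≡ t i) → s (suc n) ≡ t (suc n)
      step n s≗t with em {x ≡ s n}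
      ... | yes x≡sn = begin
        s (suc n)  ≡⟨ stay S n x≡sn ⟩
        s n        ≡⟨ s≗t n ℕ.≤-refl ⟩
        t n        ≡⟨ stay T n (trans x≡sn (s≗t n ℕ.≤-refl)) ⟨
        t (suc n)  ∎
        where open ≡-Reasoning
      ... | no x≢sn
        with p , (cp , p≤) , s≡ ← move S n x≢sn
           | q , (cq , q≤) , t≡ ← move T n (λ x≡tn → x≢sn (trans x≡tn (sym (s≗t n ℕ.≤-refl))))
        = trans s≡ (trans (cong D p≡q) (sym t≡))
        where
        p≡q : p ≡ q
        p≡q = ℕ.≤-antisym
          (p≤ q (transport (λ i i≤n → sym (s≗t i i≤n)) cq))
          (q≤ p (transport s≗t cp))

      upTo : ∀ n i → i ℕ.≤ n → s i ≡ t i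
      upTo zero    zero i≤n = trans (start S) (sym (start T))
      upTo (suc n) i    i≤n with ℕ.m≤n⇒m<n∨m≡n i≤n
      ... | inj₁ i<1+n = upTo n i (ℕ.s≤s⁻¹ i<1+n)
      ... | inj₂ refl  = step n (upTo n)

    path-unique : ∀ n → s n ≡ t n
    path-unique n = upTo n n ℕ.≤-refl

module _ {X Y : Set} (τX : Topology X) (τY : Topology Y)
         (W : ℕ → Pred X 0ℓ) (f : X → Y) where

  -- Existence of the path is part of the definition; by path-unique,
  -- quantifying over all paths to x instead would make no difference
  -- once a path exists.
  RecoverableWrt : (ℕ → X) → Set₁
  RecoverableWrt D = ∀ x → ∃[ s ] IsPath W D x s × Converges τY (f ∘ s) (f x)

  Recoverable : Set₁
  Recoverable = ∃[ D ] Dense τX (Range D) × RecoverableWrt D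

{-# OPTIONS --safe #-}
module Submission where

-- If x is not a term of D, the points on the path to x, its starting point
-- aside, are the first terms of D in the sets W m containing x.  Hence the
-- set O p of those x for which D p is such a first term is open.
--
-- If f is recoverable and the open set U is the union of closed sets F k whose
-- interiors cover it, then f x ∈ U iff for some k and p₀ we have x ∈ O p₀ and
-- f (D p) ∈ F k whenever p ≥ p₀ and x ∈ O p.  This is a countable union of
-- intersections of an open and a closed set, hence Fσ.
--
-- Conversely, let (C i) list closed sets whose unions are the preimages of a
-- countable basis of Y.  It suffices that the first term of D in W m lies in
-- C i as soon as x ∈ C i, x ∈ W m and m is large.  By goodness, for large m
-- the set W m meets none of the finitely many C j, j < i, that miss x, so C i
-- is then selected by the greedy rule that takes C 0, C 1, … in turn as long
-- as the intersection still meets W m.  D is the concatenation of finite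
-- lists, the N-th of which obeys this rule for C 0, …, C (N - 1).  Such a
-- list is built from one that ignores C 0 by putting points of C 0 in front:
-- each point outside C 0 lies in only finitely many W m meeting C 0, so
-- finitely many of them suffice.

open import Defs
open import Axiom.ExcludedMiddle using (ExcludedMiddle)
open import Data.Integer.Base as ℤ using (+_; +<+)
open import Data.List.Base using (List; []; _∷_; _++_; [_])
open import Data.List.Membership.Propositional using () renaming (_∈_ to _∈ˡ_)
open import Data.List.Relation.Unary.All as All using (All; []; _∷_)
import Data.List.Relation.Unary.All.Properties as All
open import Data.List.Relation.Unary.Any as Any using (Any; here; there)
import Data.List.Relation.Unary.Any.Properties as Any
open import Data.Nat.Base using (ℕ; zero; suc; _+_; _≤_; _<_; _⊔_; z≤n; s≤s; s≤s⁻¹)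
open import Data.Nat.Coprimality using (1-coprimeTo)
import Data.Nat.Properties as ℕ
open import Data.Product.Base using (Σ-syntax; ∃-syntax; _×_; _,_; proj₁; proj₂)
open import Data.Rational.Base as ℚ using (ℚ; mkℚ; 0ℚ; ½; *<*)
import Data.Rational.Properties as ℚ
open import Data.Sum.Base using (_⊎_; inj₁; inj₂)
open import Data.Unit.Base using (⊤; tt)
open import Function.Base using (_∘_)
open import Function.Bundles using (_⇔_; mk⇔; Equivalence)
open import Level using (0ℓ)
open import Relation.Binary.Definitions using (tri<; tri≈; tri>)
open import Relation.Binary.PropositionalEquality
  using (_≡_; _≢_; refl; sym; trans; cong; subst; module ≡-Reasoning)
open import Relation.Nullary using (¬_; yes; no; contradiction)
open import Relation.Nullary.Decidable using (decidable-stable)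
open import Relation.Unary
  using (Pred; _∈_; _∉_; _⊆_; _≐_; _≬_; _⊢_; _∩_; ∁; ⋃; ｛_｝; Satisfiable)
  renaming (U to Full)

-- Entourages of a metric space

-- All that the proof uses of a metric: a countable base of entourages.
record CountablyUniform {X : Set} (τ : Topology X) : Set₁ where
  open Topology τ
  field
    E         : ℕ → X → X → Set
    E-refl    : ∀ k x → E k x x
    E-sym     : ∀ k {x y} → E k x y → E k y x
    E-halving : ∀ k → ∃[ l ] ∀ {x y z} → E l x y → E l y z → E k x z
    E-open    : ∀ k {x y} → E k x y → ∃[ l ] ∀ {z} → E l y z → E k x z
    E-sep     : ∀ {x y} → x ≢ y → ∃[ k ] ¬ E k x y
    E⇒Open    : ∀ {U} → (∀ {x} → x ∈ U → ∃[ k ] E k x ⊆ U) → Open U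
    Open⇒E    : ∀ {U} → Open U → ∀ {x} → x ∈ U → ∃[ k ] E k x ⊆ U

-- The number 1/(k+1), since `mkℚ` stores the denominator less one.
radius : ℕ → ℚ
radius k = mkℚ (+ 1) k (1-coprimeTo (suc k))

radius-positive : ∀ k → 0ℚ ℚ.< radius k
radius-positive k = ℚ.positive⁻¹ (radius k)

radius-small : ∀ {q} → 0ℚ ℚ.< q → ∃[ k ] radius k ℚ.< q
-- A positive rational with denominator d+1 is at least 1/(d+1), which exceeds 1/(d+2).
radius-small {mkℚ (+ suc n) d _} _ = suc d , *<* (+<+ (ℕ.*-monoˡ-≤ (suc (suc d)) (s≤s (z≤n {n}))))
radius-small {mkℚ (+ 0) d _} (*<* (+<+ ()))
radius-small {mkℚ (ℤ.-[1+ n ]) d _} (*<* ())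

0<½q : ∀ {q} → 0ℚ ℚ.< q → 0ℚ ℚ.< ½ ℚ.* q
0<½q {q} 0<q = subst (ℚ._< ½ ℚ.* q) (ℚ.*-zeroʳ ½) (ℚ.*-monoʳ-<-pos ½ 0<q)

½q+½q≡q : ∀ q → ½ ℚ.* q ℚ.+ ½ ℚ.* q ≡ q
½q+½q≡q q = trans (sym (ℚ.*-distribʳ-+ q ½ ½)) (ℚ.*-identityˡ q)

p+[q-p]≡q : ∀ p q → p ℚ.+ (q ℚ.- p) ≡ q
p+[q-p]≡q p q = begin
  p ℚ.+ (q ℚ.- p)      ≡⟨ cong (p ℚ.+_) (ℚ.+-comm q (ℚ.- p)) ⟩
  p ℚ.+ (ℚ.- p ℚ.+ q)  ≡⟨ ℚ.+-assoc p (ℚ.- p) q ⟨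
  (p ℚ.- p) ℚ.+ q      ≡⟨ cong (ℚ._+ q) (ℚ.+-inverseʳ p) ⟩
  0ℚ ℚ.+ q             ≡⟨ ℚ.+-identityˡ q ⟩
  q                    ∎
  where open ≡-Reasoning

p<q⇒0<q-p : ∀ {p q} → p ℚ.< q → 0ℚ ℚ.< q ℚ.- p
p<q⇒0<q-p {p} {q} p<q =
  subst (ℚ._< q ℚ.- p) (ℚ.+-inverseʳ p) (ℚ.+-monoˡ-< (ℚ.- p) p<q)

module Cuts where
  open ℝ

  ∉-upward : ∀ x {p q} → p ℚ.≤ q → p ∉ cut x → q ∉ cut x
  ∉-upward x {p} {q} p≤q p∉x q∈x with ℚ.<-cmp p q
  ... | tri< p<q _ _ = p∉x (lower x p<q q∈x)
  ... | tri≈ _ refl _ = p∉x q∈x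
  ... | tri> _ _ q<p = ℚ.<-irrefl refl (ℚ.≤-<-trans p≤q q<p)

  ∉-+ : ∀ x y {p q} → p ∉ cut x → q ∉ cut y → p ℚ.+ q ∉ cut (x +ᴿ y)
  ∉-+ x y p∉x q∉y (a , b , a∈x , b∈y , p+q≡a+b) =
    ℚ.<-irrefl (sym p+q≡a+b)
      (ℚ.+-mono-< (ℚ.≰⇒> λ p≤a → ∉-upward x p≤a p∉x a∈x)
                  (ℚ.≰⇒> λ q≤b → ∉-upward y q≤b q∉y b∈y))

  0<ᴿε⇒0<q∈ε : ∀ ε → 0ᴿ <ᴿ ε → ∃[ q ] 0ℚ ℚ.< q × q ∈ cut ε
  0<ᴿε⇒0<q∈ε ε (p , p≮0 , p∈ε) with q , p<q , q∈ε ← noMax ε p∈ε =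
    q , ℚ.≤-<-trans (ℚ.≮⇒≥ p≮0) p<q , q∈ε

module Classical (em : ∀ {ℓ} → ExcludedMiddle ℓ) where

  ¬∀⇒∃¬ : ∀ {a b} {A : Set a} {P : A → Set b} → ¬ (∀ x → P x) → ∃[ x ] ¬ P x
  ¬∀⇒∃¬ ¬∀ = decidable-stable em λ ¬∃ →
    ¬∀ λ x → decidable-stable em λ ¬p → ¬∃ (x , ¬p)

  ∃-least : ∀ {P : Pred ℕ 0ℓ} {n} → n ∈ P → ∃[ m ] IsLeast P m
  ∃-least {P} {zero}  n∈P = 0 , n∈P , λ _ _ → z≤n
  ∃-least {P} {suc n} n∈P with em {P = 0 ∈ P}
  ... | yes 0∈P = 0 , 0∈P , λ _ _ → z≤n
  ... | no  0∉P with m , m∈P , m≤ ← ∃-least {P ∘ suc} n∈P =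
    suc m , m∈P , λ { zero 0∈P → contradiction 0∈P 0∉P ; (suc q) q∈P → s≤s (m≤ q q∈P) }

  -- Each p is used at most once, so the finitely many p below B are all used up before some N.
  used-once⇒→∞ : ∀ {T : ℕ → ℕ → Set} → (∀ {n n′ p} → n < n′ → T n p → ¬ T n′ p) →
                 ∀ B → ∃[ N ] ∀ n → N ≤ n → ∀ p → T n p → B ≤ p
  used-once⇒→∞ once zero = 0 , λ _ _ _ _ → z≤n
  used-once⇒→∞ {T} once (suc B) with N , N≤⇒ ← used-once⇒→∞ once B | em {P = ∃[ n ] T n B}
  ... | yes (n , nTB) = N ⊔ suc n , λ n′ le p n′Tp → ℕ.≤∧≢⇒< (N≤⇒ n′ (ℕ.m⊔n≤o⇒m≤o N _ le) p n′Tp)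
    λ { refl → once (ℕ.m⊔n≤o⇒n≤o N _ le) nTB n′Tp }
  ... | no ¬nTB = N , λ n le p nTp → ℕ.≤∧≢⇒< (N≤⇒ n le p nTp) λ { refl → ¬nTB (n , nTp) }

  metrizable⇒uniform : ∀ {X} {τ : Topology X} → Metrizable τ → CountablyUniform τ
  metrizable⇒uniform {X} {τ} (ρ , Open⇔) = record
    { E         = λ k x y → d x y <ᴿ fromℚ (radius k)
    ; E-refl    = λ k x → 0ℚ , 0∉dxx x , radius-positive k
    ; E-sym     = λ { k {x} {y} (p , p∉ , p<) → p , p∉ ∘ proj₂ (symm x y) , p< }
    ; E-halving = halving
    ; E-open    = ball-open
    ; E-sep     = λ {x} {y} → separation x y
    ; E⇒Open    = λ {U} U⊇ → Equivalence.from (Open⇔ U) λ x∈U →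
        let k , E⊆U = U⊇ x∈U in
        fromℚ (radius k) , (0ℚ , ℚ.<-irrefl refl , radius-positive k) , E⊆U
    ; Open⇒E    = λ {U} oU {x} x∈U →
        let ε , 0<ε , ball⊆U = Equivalence.to (Open⇔ U) oU x∈U
            q , 0<q , q∈ε    = 0<ᴿε⇒0<q∈ε ε 0<ε
            k , r<q          = radius-small 0<q
        in k , λ (p , p∉ , p<r) → ball⊆U (p , p∉ , ℝ.lower ε (ℚ.<-trans p<r r<q) q∈ε)
    }
    where
    open Metric ρ
    open ℝ
    open Cuts

    0∉dxx : ∀ x → 0ℚ ∉ cut (d x x)
    0∉dxx x 0∈ = ℚ.<-irrefl refl (proj₁ (Equivalence.from (identity x x) refl) 0∈)

    ∉-triangle : ∀ {x y z p q} → p ∉ cut (d x y) → q ∉ cut (d y z) → p ℚ.+ q ∉ cut (d x z)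
    ∉-triangle {x} {y} {z} p∉ q∉ = ∉-+ (d x y) (d y z) p∉ q∉ ∘ triangle x y z

    halving : ∀ k → ∃[ l ] ∀ {x y z} → d x y <ᴿ fromℚ (radius l) →
              d y z <ᴿ fromℚ (radius l) → d x z <ᴿ fromℚ (radius k)
    halving k with l , r<½ ← radius-small (0<½q (radius-positive k)) =
      l , λ (p , p∉ , p<) (q , q∉ , q<) → p ℚ.+ q , ∉-triangle p∉ q∉ ,
        subst (p ℚ.+ q ℚ.<_) (½q+½q≡q (radius k))
          (ℚ.+-mono-< (ℚ.<-trans p< r<½) (ℚ.<-trans q< r<½))

    ball-open : ∀ k {x y} → d x y <ᴿ fromℚ (radius k) →
                ∃[ l ] ∀ {z} → d y z <ᴿ fromℚ (radius l) → d x z <ᴿ fromℚ (radius k)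
    ball-open k (p , p∉ , p<) with l , r< ← radius-small (p<q⇒0<q-p p<) =
      l , λ (q , q∉ , q<) → p ℚ.+ q , ∉-triangle p∉ q∉ ,
        subst (p ℚ.+ q ℚ.<_) (p+[q-p]≡q p (radius k))
          (ℚ.+-monoʳ-< p (ℚ.<-trans q< r<))

    separation : ∀ x y → x ≢ y → ∃[ k ] ¬ d x y <ᴿ fromℚ (radius k)
    separation x y x≢y = ¬∀⇒∃¬ λ close → x≢y (Equivalence.to (identity x y)
      ((λ {q} q∈d → ℚ.≰⇒> (λ 0≤q → far close 0≤q q∈d)) , nonneg x y))
      where
      far : (∀ k → d x y <ᴿ fromℚ (radius k)) → ∀ {q} → 0ℚ ℚ.≤ q → q ∉ cut (d x y)
      -- Passing to a larger q′ in the cut makes it positive, also when q is 0, so that some radius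
      -- fits below it.
      far close 0≤q q∈d with q′ , q<q′ , q′∈d ← noMax (d x y) q∈d
        with k , r<q′ ← radius-small (ℚ.≤-<-trans 0≤q q<q′)
        with p , p∉d , p<r ← close k =
        p∉d (lower (d x y) (ℚ.<-trans p<r r<q′) q′∈d)

-- Enumeration of pairs

-- Runs along an antidiagonal from (0 , s) to (s , 0), then jumps to the start of the next one.
advance : ℕ × ℕ → ℕ × ℕ
advance (a , zero)  = 0 , suc a
advance (a , suc b) = suc a , b

unpair : ℕ → ℕ × ℕ
unpair zero    = 0 , 0
unpair (suc n) = advance (unpair n)

unpair-surjective : ∀ a b → ∃[ n ] unpair n ≡ (a , b)
unpair-surjective a b = onDiagonal (a + b) a b refl
  where
  onDiagonal : ∀ s a b → a + b ≡ s → ∃[ n ] unpair n ≡ (a , b)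
  onDiagonal s (suc a) b eq
    with n , n↦ ← onDiagonal s a (suc b) (trans (ℕ.+-suc a b) eq) = suc n , cong advance n↦
  onDiagonal s zero zero eq = 0 , refl
  onDiagonal (suc s) zero (suc b) eq
    with n , n↦ ← onDiagonal s b 0 (trans (ℕ.+-identityʳ b) (ℕ.suc-injective eq)) =
    suc n , cong advance n↦

-- Open, closed and Fσ sets

module TopologyProperties {X : Set} (τ : Topology X) where
  open Topology τ

  Fσ-⋃ : ∀ {A : ℕ → Pred X 0ℓ} → (∀ n → Fσ (A n)) → Fσ (⋃ ℕ A)
  Fσ-⋃ {A} FσA =
      (λ n → let a , b = unpair n in proj₁ (FσA a) b)
    , (λ n → let a , b = unpair n in proj₁ (proj₂ (FσA a)) b)
    , (λ (a , x∈A) → let b , x∈C = proj₁ (proj₂ (proj₂ (FσA a))) x∈A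
                         n , n↦  = unpair-surjective a b
                     in n , subst (λ (a , b) → proj₁ (FσA a) b _) (sym n↦) x∈C)
    , (λ (n , x∈C) → let a , b = unpair n in a , proj₂ (proj₂ (proj₂ (FσA a))) (b , x∈C))

  Fσ-resp : ∀ {A B} → A ≐ B → Fσ A → Fσ B
  Fσ-resp (A⊆B , B⊆A) (C , closed , A⊆C , C⊆A) = C , closed , A⊆C ∘ B⊆A , A⊆B ∘ C⊆A

  Open-∀< : ∀ {U : ℕ → Pred X 0ℓ} → (∀ i → Open (U i)) →
            ∀ n → Open (λ x → ∀ i → i < n → x ∈ U i)
  Open-∀< oU zero    = Open-resp ((λ _ _ ()) , _) Open-Full
  Open-∀< {U} oU (suc n) = Open-resp
    ( (λ (below , at) i i<1+n → extend below at (ℕ.m<1+n⇒m<n∨m≡n i<1+n))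
    , λ all → (λ i i<n → all i (ℕ.m<n⇒m<1+n i<n)) , all n (ℕ.n<1+n n))
    (Open-∩ (Open-∀< oU n) (oU n))
    where
    extend : ∀ {i x} → (∀ i → i < n → x ∈ U i) → x ∈ U n → i < n ⊎ i ≡ n → x ∈ U i
    extend below at (inj₁ i<n)  = below _ i<n
    extend below at (inj₂ refl) = at

module UniformTopology (em : ∀ {ℓ} → ExcludedMiddle ℓ)
                       {X : Set} {τ : Topology X} (unif : CountablyUniform τ) where
  open Topology τ
  open CountablyUniform unif
  open TopologyProperties τ

  Closed-singleton : ∀ c → Closed ｛ c ｝
  Closed-singleton c = E⇒Open λ c≢x →
    let k , ¬E = E-sep (c≢x ∘ sym) in k , λ { Exz refl → ¬E Exz }

  Closed-∩ : ∀ {A B} → Closed A → Closed B → Closed (A ∩ B)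
  Closed-∩ {A} {B} cA cB = E⇒Open avoid
    where
    avoid : ∀ {x} → x ∉ A ∩ B → ∃[ k ] E k x ⊆ ∁ (A ∩ B)
    avoid {x} x∉A∩B with em {P = x ∈ A}
    ... | yes x∈A with k , E⊆ ← Open⇒E cB (x∉A∩B ∘ (x∈A ,_)) = k , λ Exz → E⊆ Exz ∘ proj₂
    ... | no  x∉A with k , E⊆ ← Open⇒E cA x∉A = k , λ Exz → E⊆ Exz ∘ proj₁

  Open-E : ∀ k x → Open (E k x)
  Open-E k x = E⇒Open (E-open k)

  -- These serve as the closed sets F k of the introduction.
  Core : ℕ → Pred X 0ℓ → Pred X 0ℓ
  Core k U x = E k x ⊆ U

  Core-⊆ : ∀ k {U} → Core k U ⊆ U
  Core-⊆ k core = core (E-refl k _)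

  -- If some z outside U is k-close to x, then every y near enough to x is also k-close to z,
  -- because entourage neighbourhoods are open.
  Closed-Core : ∀ k U → Closed (Core k U)
  Closed-Core k U = E⇒Open λ {x} x∉core →
    let z , ¬[] = Classical.¬∀⇒∃¬ em {P = λ z → E k x z → z ∈ U} (λ all → x∉core λ {z} → all z)
        Exz = decidable-stable em λ ¬Exz → ¬[] λ Exz → contradiction Exz ¬Exz
        l , E⊆ = E-open k (E-sym k Exz)
    in l , λ Exy core → ¬[] λ _ → core (E-sym k (E⊆ Exy))

  Core-neighbourhood : ∀ {U} → Open U → ∀ {x} → x ∈ U → ∃[ l ] E l x ⊆ Core l U
  Core-neighbourhood oU x∈U with k , E⊆U ← Open⇒E oU x∈U with l , E∘E⊆E ← E-halving k =
    l , λ Exy Eyz → E⊆U (E∘E⊆E Exy Eyz)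

  Open⇒Fσ : ∀ {U} → Open U → Fσ U
  Open⇒Fσ {U} oU =
    (λ k → Core k U) , (λ k → Closed-Core k U) , Open⇒E oU , λ (k , core) → Core-⊆ k core

  Fσ-∩-Closed : ∀ {A B} → Fσ A → Closed B → Fσ (A ∩ B)
  Fσ-∩-Closed {A} {B} (C , closed , A⊆C , C⊆A) cB =
      (λ n → C n ∩ B) , (λ n → Closed-∩ (closed n) cB)
    , (λ (x∈A , x∈B) → let n , x∈C = A⊆C x∈A in n , x∈C , x∈B)
    , (λ (n , x∈C , x∈B) → C⊆A (n , x∈C) , x∈B)

-- First terms in basic sets and the path to a point outside the sequence

module FirstTerms {X : Set} (W : ℕ → Pred X 0ℓ) (D : ℕ → X) where

  First : ℕ → ℕ → Set
  First m = IsLeast (λ p → D p ∈ W m)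

  -- The set O p of the introduction.
  Leads : ℕ → Pred X 0ℓ
  Leads p x = ∃[ m ] x ∈ W m × First m p

  Move : X → (ℕ → X) → ℕ → ℕ → Set
  Move x s n p = IsLeast (Candidate W D x s n) p × s (suc n) ≡ D p

  -- Every term of `D` in the set `W m` that justifies the move is itself a candidate through that
  -- m, so the least candidate is the first term in `W m`.
  Move⇒First : ∀ {x s n p} → Move x s n p →
               ∃[ m ] x ∈ W m × First m p × W m ⊆ ∁ (Initial W D x s n)
  Move⇒First (((m , sub , avoid) , least) , _) = m , sub (inj₁ refl)
    , ( sub (inj₂ refl)
      , λ q Dq∈W → least q
          (m , (λ { (inj₁ refl) → sub (inj₁ refl) ; (inj₂ refl) → Dq∈W }) , λ {y} → avoid {y}))
    , λ {y} → avoid {y}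

module PathOff {X : Set} (em : ∀ {ℓ} → ExcludedMiddle ℓ)
               (W : ℕ → Pred X 0ℓ) (D : ℕ → X) (x : X) (x∉D : x ∉ Range D)
               (s : ℕ → X) (path : IsPath W D x s) where
  open FirstTerms W D
  open Classical em
  open IsPath path

  off : ∀ n → x ≢ s n
  off zero    x≡s₀ = x∉D (0 , trans x≡s₀ start)
  off (suc n) x≡s with p , _ , s≡D ← move n (off n) = x∉D (p , trans x≡s s≡D)

  visits : ∀ n → s n ∈ Range D
  visits zero    = 0 , start
  visits (suc n) with p , _ , s≡D ← move n (off n) = p , s≡D

  Move-once : ∀ {n n′ p} → n < n′ → Move x s n p → ¬ Move x s n′ p
  Move-once n<n′ (_ , s≡D) (((m , sub , avoid) , _) , _) =
    avoid (sub (inj₂ refl)) (_ , n<n′ , sym s≡D)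

  Move⇒Leads : ∀ {n p} → Move x s n p → x ∈ Leads p
  Move⇒Leads mv with m , x∈W , first , _ ← Move⇒First mv = m , x∈W , first

  -- If `D p` were never visited, the path would never enter `W m`: a visited term in it has index
  -- at least p by `least`, and at most p since p is a candidate. So p would remain a candidate
  -- forever and bound all chosen indices, which tend to infinity by `Move-once`.
  Leads⇒visited : ∀ {p} → x ∈ Leads p → ∃[ n ] s n ≡ D p
  Leads⇒visited {p} (m , x∈W , Dp∈W , least) = decidable-stable em λ unvisited →
    let N , late = used-once⇒→∞ {T = Move x s} Move-once (suc p)
        q , mv   = move N (off N)
    in contradiction (proj₂ (proj₁ mv) p (candidate (avoids unvisited N)))
                     (ℕ.<⇒≱ (late N ℕ.≤-refl q mv))
    where
    candidate : ∀ {n} → (∀ i → i ≤ n → s i ∉ W m) → Candidate W D x s n p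
    candidate outside = m , (λ { (inj₁ refl) → x∈W ; (inj₂ refl) → Dp∈W })
      , λ { y∈W (i , i≤n , refl) → outside i i≤n y∈W }

    avoids : ¬ (∃[ n ] s n ≡ D p) → ∀ n i → i ≤ n → s i ∉ W m
    avoids unvisited zero zero _ s∈W =
      unvisited (0 , trans start (cong D (sym (ℕ.n≤0⇒n≡0 (least 0 (subst (_∈ W m) start s∈W))))))
    avoids unvisited (suc n) i i≤1+n s∈W with ℕ.m≤n⇒m<n∨m≡n i≤1+n
    ... | inj₁ i<1+n = avoids unvisited n i (s≤s⁻¹ i<1+n) s∈W
    ... | inj₂ refl with q , (_ , q≤) , s≡D ← move n (off n) =
      unvisited (suc n , trans s≡D (cong D (ℕ.≤-antisym
        (q≤ p (candidate (avoids unvisited n)))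
        (least q (subst (_∈ W m) s≡D s∈W)))))

  -- `D` may repeat values, so s n does not determine p. But if s n is `D i`, then `D i` lies in the
  -- set in which p comes first, whence p ≤ i.
  early-bounded : ∀ N → ∃[ B ] ∀ n → n < N → ∀ p → x ∈ Leads p → s n ≡ D p → p < B
  early-bounded zero    = 0 , λ _ ()
  early-bounded (suc N) with B , bounded ← early-bounded N | i , s≡Di ← visits N =
    B ⊔ suc i , λ n n<1+N → bound (ℕ.m<1+n⇒m<n∨m≡n n<1+N)
    where
    bound : ∀ {n} → n < N ⊎ n ≡ N → ∀ p → x ∈ Leads p → s n ≡ D p → p < B ⊔ suc i
    bound (inj₁ n<N)  p lead s≡Dp = ℕ.m≤n⇒m≤n⊔o (suc i) (bounded _ n<N p lead s≡Dp)
    bound (inj₂ refl) p (m , _ , Dp∈W , least) s≡Dp =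
      ℕ.m≤n⇒m≤o⊔n B (s≤s (least i (subst (_∈ W m) (trans (sym s≡Dp) s≡Di) Dp∈W)))

  -- Take p₀ from a move so late that p₀ exceeds every leading index whose term is visited before
  -- step N.
  Leads-tail : ∀ N → ∃[ p₀ ] x ∈ Leads p₀ ×
               (∀ p → p₀ ≤ p → x ∈ Leads p → ∃[ n ] N ≤ n × s n ≡ D p)
  Leads-tail N with B , bounded ← early-bounded N
    with N′ , late ← used-once⇒→∞ {T = Move x s} Move-once B
    with p₀ , mv ← move N′ (off N′) =
    p₀ , Move⇒Leads mv , λ p p₀≤p lead →
      let n , s≡D = Leads⇒visited lead in
      n , ℕ.≮⇒≥ (λ n<N → ℕ.<⇒≱ (bounded n n<N p lead s≡D)
                           (ℕ.≤-trans (late N′ ℕ.≤-refl p₀ mv) p₀≤p))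
        , s≡D

-- Recoverable functions are Baire class one

module RecoverableToBaire
  (em : ∀ {ℓ} → ExcludedMiddle ℓ) {X Y : Set} {τX : Topology X} {τY : Topology Y}
  (unifX : CountablyUniform τX) (unifY : CountablyUniform τY)
  (W : ℕ → Pred X 0ℓ) (basis : Topology.IsBasis τX W)
  (f : X → Y) (D : ℕ → X) (recoverable : RecoverableWrt τX τY W f D) where

  open Topology
  open Classical em
  open FirstTerms W D
  open TopologyProperties τX
  module TX = UniformTopology em unifX
  module TY = UniformTopology em unifY

  Leads-open : ∀ p → Open τX (Leads p)
  Leads-open p = Open-resp τX
    ((λ ((m , first) , x∈W) → m , x∈W , first) , λ (m , x∈W , first) → (m , first) , x∈W)
    (Open-⋃ τX {I = Σ[ m ∈ ℕ ] First m p} (proj₁ basis ∘ proj₁))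

  module _ {q : ℕ} (q-earliest : ∀ j → D q ≡ D j → q ≤ j) where

    -- The points `D j` with j < q differ from `D q`, so some basic set around `D q` misses them
    -- all. With `Leads-≤`, q is then the last index that leads `D q`.
    Leads-self : D q ∈ Leads q
    Leads-self with m , Dq∈W , W⊆ ← proj₂ basis (Open-∀< (λ i → TX.Closed-singleton (D i)) q)
                      (λ j j<q Dj≡Dq → ℕ.<⇒≱ j<q (q-earliest j (sym Dj≡Dq))) =
      m , Dq∈W , Dq∈W , λ j Dj∈W → ℕ.≮⇒≥ λ j<q → W⊆ Dj∈W j j<q refl

    Leads-≤ : ∀ {p} → D q ∈ Leads p → p ≤ q
    Leads-≤ (m , Dq∈W , _ , least) = least q Dq∈W

  EventuallyIn : Pred Y 0ℓ → ℕ → Pred X 0ℓ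
  EventuallyIn F p₀ x = ∀ p → p₀ ≤ p → x ∈ Leads p → f (D p) ∈ F

  -- The complement is the union of the open sets `Leads p` over the p ≥ p₀ with `f (D p)` outside
  -- F.
  EventuallyIn-closed : ∀ F p₀ → Closed τX (EventuallyIn F p₀)
  EventuallyIn-closed F p₀ = Open-resp τX
    ( (λ ((p , p₀≤p , f∉F) , lead) all → f∉F (all p p₀≤p lead))
    , λ ¬all → decidable-stable em λ ¬∃ → ¬all λ p p₀≤p lead →
        decidable-stable em λ f∉F → ¬∃ ((p , p₀≤p , f∉F) , lead))
    (Open-⋃ τX {I = Σ[ p ∈ ℕ ] p₀ ≤ p × f (D p) ∉ F} (Leads-open ∘ proj₁))

  preimage-decomposition : ∀ {U} → Open τY U →
    (⋃ ℕ λ k → ⋃ ℕ λ p₀ → Leads p₀ ∩ EventuallyIn (TY.Core k U) p₀) ≐ (f ⊢ U)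
  preimage-decomposition {U} oU = ⊆U , U⊆
    where
    earliest : ∀ {x} → x ∈ Range D → ∃[ q ] x ≡ D q × (∀ j → D q ≡ D j → q ≤ j)
    earliest (_ , x≡D) with q , x≡Dq , least ← ∃-least x≡D =
      q , x≡Dq , λ j Dq≡Dj → least j (trans x≡Dq Dq≡Dj)

    ⊆U : ∀ {x} → x ∈ (⋃ ℕ λ k → ⋃ ℕ λ p₀ → Leads p₀ ∩ EventuallyIn (TY.Core k U) p₀) →
         f x ∈ U
    ⊆U {x} (k , p₀ , lead , inCore) with em {P = x ∈ Range D}
    -- Here p₀ ≤ q by `Leads-≤`, so `inCore` applies to q itself.
    ... | yes x∈D with q , refl , q-earliest ← earliest x∈D =
      TY.Core-⊆ k (inCore q (Leads-≤ q-earliest lead) (Leads-self q-earliest))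
    -- Otherwise the images along the path would eventually leave the closed core, while late moves
    -- use leading indices beyond p₀, whose images lie in it.
    ... | no x∉D with s , path , conv ← recoverable x = TY.Core-⊆ k (decidable-stable em λ fx∉core →
      let open PathOff em W D x x∉D s path
          N , N≤⇒∉ = conv (TY.Closed-Core k U) fx∉core
          N′ , late = used-once⇒→∞ {T = Move x s} Move-once p₀
          p , mv = IsPath.move path (N ⊔ N′) (off (N ⊔ N′))
      in N≤⇒∉ (suc (N ⊔ N′)) (ℕ.m≤n⇒m≤1+n (ℕ.m≤m⊔n N N′))
           (subst (λ y → f y ∈ TY.Core k U) (sym (proj₂ mv))
             (inCore p (late (N ⊔ N′) (ℕ.m≤n⊔m N N′) p mv) (Move⇒Leads mv))))

    U⊆ : ∀ {x} → f x ∈ U →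
         x ∈ (⋃ ℕ λ k → ⋃ ℕ λ p₀ → Leads p₀ ∩ EventuallyIn (TY.Core k U) p₀)
    U⊆ {x} fx∈U with k , E⊆core ← TY.Core-neighbourhood oU fx∈U | em {P = x ∈ Range D}
    -- Take p₀ = q: beyond it only q leads x, so nothing but f x has to be checked.
    ... | yes x∈D with q , refl , q-earliest ← earliest x∈D =
      k , q , Leads-self q-earliest , λ p q≤p lead →
        subst (λ j → f (D j) ∈ TY.Core k U) (ℕ.≤-antisym q≤p (Leads-≤ q-earliest lead))
          (E⊆core (CountablyUniform.E-refl unifY k _))
    ... | no x∉D with s , path , conv ← recoverable x
      with N , N≤⇒ ← conv (TY.Open-E k (f x)) (CountablyUniform.E-refl unifY k (f x))
      with p₀ , lead₀ , tail ← PathOff.Leads-tail em W D x x∉D s path N =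
      k , p₀ , lead₀ , λ p p₀≤p lead → let n , N≤n , s≡D = tail p p₀≤p lead in
        E⊆core (subst (λ y → f y ∈ CountablyUniform.E unifY k (f x)) s≡D (N≤⇒ n N≤n))

  baireClassOne : BaireClassOne τX τY f
  baireClassOne {U} oU = Fσ-resp (preimage-decomposition oU)
    (Fσ-⋃ λ k → Fσ-⋃ λ p₀ →
      TX.Fσ-∩-Closed (TX.Open⇒Fσ (Leads-open p₀)) (EventuallyIn-closed (TY.Core k U) p₀))

-- Lists and their infinite concatenation

-- Vacuous for lists that miss V, and so preserved by concatenation.
FirstIn : {X : Set} → Pred X 0ℓ → Pred X 0ℓ → List X → Set
FirstIn V G []       = ⊤
FirstIn V G (y ∷ ys) = (y ∈ V → y ∈ G) × (y ∉ V → FirstIn V G ys)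

module FirstInProperties {X : Set} where

  FirstIn-++ : ∀ {V G : Pred X 0ℓ} L {L′} → FirstIn V G L → FirstIn V G L′ → FirstIn V G (L ++ L′)
  FirstIn-++ []      _           f′ = f′
  FirstIn-++ (y ∷ L) (at , past) f′ = at , λ y∉V → FirstIn-++ L (past y∉V) f′

  FirstIn-++ˡ : ∀ {V G : Pred X 0ℓ} {L} L′ → Any (_∈ V) L → FirstIn V G L → FirstIn V G (L ++ L′)
  FirstIn-++ˡ L′ (here y∈V) (at , past) = at , contradiction y∈V
  FirstIn-++ˡ L′ (there L≬V) (at , past) = at , λ y∉V → FirstIn-++ˡ L′ L≬V (past y∉V)

  FirstIn-map : ∀ {V G G′ : Pred X 0ℓ} L → (∀ {y} → y ∈ V → y ∈ G → y ∈ G′) →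
                FirstIn V G L → FirstIn V G′ L
  FirstIn-map []      G⊆G′ _           = tt
  FirstIn-map (y ∷ L) G⊆G′ (at , past) =
    (λ y∈V → G⊆G′ y∈V (at y∈V)) , λ y∉V → FirstIn-map L G⊆G′ (past y∉V)

  FirstIn-vacuous : ∀ {V G : Pred X 0ℓ} L → ¬ Any (_∈ V) L → FirstIn V G L
  FirstIn-vacuous []      _    = tt
  FirstIn-vacuous (y ∷ L) ¬any =
    (λ y∈V → contradiction (here y∈V) ¬any) , λ _ → FirstIn-vacuous L (¬any ∘ there)

-- The infinite concatenation of the nonempty lists head N ∷ tail N.
module Concatenation {X : Set} (head : ℕ → X) (tail : ℕ → List X) where

  -- A state consists of the current term, the remainder of its list and the number of that list.
  next : X × List X × ℕ → X × List X × ℕ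
  next (_ , []     , N) = head (suc N) , tail (suc N) , suc N
  next (_ , y ∷ ys , N) = y , ys , N

  state : ℕ → X × List X × ℕ
  state zero    = head 0 , tail 0 , 0
  state (suc p) = next (state p)

  term : ℕ → X
  term p = proj₁ (state p)

  rest : ℕ → List X
  rest p = proj₁ (proj₂ (state p))

  block : ℕ → ℕ
  block p = proj₂ (proj₂ (state p))

  block-starts : ∀ N → ∃[ p ] state p ≡ (head N , tail N , N)
  block-starts zero    = 0 , refl
  block-starts (suc N) with p , eq ← block-starts N = skip p (tail N) eq
    where
    skip : ∀ p ys {y} → state p ≡ (y , ys , N) →
           ∃[ q ] state q ≡ (head (suc N) , tail (suc N) , suc N)
    skip p []       eq = suc p , cong next eq
    skip p (_ ∷ ys) eq = skip (suc p) ys (cong next eq)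

  ∈block⇒∈Range : ∀ {N x} → x ∈ˡ head N ∷ tail N → x ∈ Range term
  ∈block⇒∈Range {N} x∈ with p , eq ← block-starts N = search p eq x∈
    where
    search : ∀ p {x y ys} → state p ≡ (y , ys , N) → x ∈ˡ y ∷ ys → x ∈ Range term
    search p             eq (here x≡y) = p , trans x≡y (cong proj₁ (sym eq))
    search p {ys = _ ∷ _} eq (there x∈) = search (suc p) (cong next eq) x∈

  block-mono : ∀ {p q} → p ≤ q → block p ≤ block q
  block-mono {p} {q} p≤q with q′ , refl ← ℕ.m≤n⇒∃[o]m+o≡n p≤q =
    subst (λ n → block p ≤ block n) (ℕ.+-comm q′ p) (later q′)
    where
    next-mono : ∀ st → proj₂ (proj₂ st) ≤ proj₂ (proj₂ (next st))
    next-mono (_ , []    , N) = ℕ.n≤1+n N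
    next-mono (_ , _ ∷ _ , N) = ℕ.≤-refl

    later : ∀ k → block p ≤ block (k + p)
    later zero    = ℕ.≤-refl
    later (suc k) = ℕ.≤-trans (later k) (next-mono (state (k + p)))

  block-unbounded : ∀ N → ∃[ p₀ ] ∀ p → p₀ ≤ p → N ≤ block p
  block-unbounded N with p₀ , eq ← block-starts N =
    p₀ , λ p p₀≤p → subst (_≤ block p) (cong (proj₂ ∘ proj₂) eq) (block-mono p₀≤p)

  -- While no term has been in V, the current term and the remainder of its list still satisfy
  -- `FirstIn`; a new list brings the property afresh.
  first-term : ∀ {V} {G : ℕ → Pred X 0ℓ} → (∀ N → FirstIn V (G N) (head N ∷ tail N)) →
               ∀ p → (∀ q → q < p → term q ∉ V) → term p ∈ V → term p ∈ G (block p)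
  first-term {V} {G} firstIn p earlier∉ = proj₁ (remaining p earlier∉)
    where
    step : ∀ ((x , xs , N) : X × List X × ℕ) → FirstIn V (G N) (x ∷ xs) → x ∉ V →
           let (y , ys , M) = next (x , xs , N) in FirstIn V (G M) (y ∷ ys)
    step (x , []     , N) _ x∉V = firstIn (suc N)
    step (x , y ∷ ys , N) f x∉V = proj₂ f x∉V

    remaining : ∀ p → (∀ q → q < p → term q ∉ V) → FirstIn V (G (block p)) (term p ∷ rest p)
    remaining zero    _        = firstIn 0
    remaining (suc p) earlier∉ = step (state p)
      (remaining p λ q q<p → earlier∉ q (ℕ.m<n⇒m<1+n q<p)) (earlier∉ p ℕ.≤-refl)

-- Greedy lists

-- Greedy n C K m r says that r ∈ K lies in those of C 0, …, C (n - 1), chosen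
-- greedily in this order, whose common part with K still meets W m.
module GreedyLists {X : Set} (em : ∀ {ℓ} → ExcludedMiddle ℓ)
                   {τ : Topology X} (W : ℕ → Pred X 0ℓ) (good : Topology.IsGoodBasis τ W) where
  open Topology τ
  open FirstInProperties

  Greedy : ℕ → (ℕ → Pred X 0ℓ) → Pred X 0ℓ → ℕ → Pred X 0ℓ
  Greedy zero    C K m r = r ∈ K
  Greedy (suc n) C K m r =
    (W m ≬ (K ∩ C 0) → r ∈ Greedy n (C ∘ suc) (K ∩ C 0) m) ×
    (¬ (W m ≬ (K ∩ C 0)) → r ∈ Greedy n (C ∘ suc) K m)

  Greedy⇒∈ : ∀ n {C K m r} → r ∈ Greedy n C K m → r ∈ K
  Greedy⇒∈ zero r∈K = r∈K
  Greedy⇒∈ (suc n) {C} {K} {m} (meets , misses) with em {P = W m ≬ (K ∩ C 0)}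
  ... | yes W≬  = proj₁ (Greedy⇒∈ n (meets W≬))
  ... | no  ¬W≬ = Greedy⇒∈ n (misses ¬W≬)

  -- Before stage i the rule takes exactly those C j that contain x, so x stays in the current
  -- intersection and witnesses that C i is taken too.
  Greedy⇒∈C : ∀ n {i C K m r x} → i < n → x ∈ W m → x ∈ K → x ∈ C i →
              (∀ j → j < i → x ∉ C j → W m ⊆ ∁ (C j)) → r ∈ Greedy n C K m → r ∈ C i
  Greedy⇒∈C (suc n) {zero} i<n x∈W x∈K x∈C misses (meets , _) =
    proj₂ (Greedy⇒∈ n (meets (_ , x∈W , x∈K , x∈C)))
  Greedy⇒∈C (suc n) {suc i} {C} {x = x} i<n x∈W x∈K x∈C W⊆∁ (meets , misses) with em {P = x ∈ C 0}
  ... | yes x∈C₀ = Greedy⇒∈C n (s≤s⁻¹ i<n) x∈W (x∈K , x∈C₀) x∈C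
    (λ j j<i → W⊆∁ (suc j) (s≤s j<i)) (meets (_ , x∈W , x∈K , x∈C₀))
  ... | no  x∉C₀ = Greedy⇒∈C n (s≤s⁻¹ i<n) x∈W x∈K x∈C
    (λ j j<i → W⊆∁ (suc j) (s≤s j<i))
    (misses λ (_ , y∈W , _ , y∈C₀) → W⊆∁ 0 (s≤s z≤n) x∉C₀ y∈W y∈C₀)

  GreedyList : ℕ → (ℕ → Pred X 0ℓ) → Pred X 0ℓ → List X → Set
  GreedyList n C K L = All (_∈ K) L × (∀ m → FirstIn (W m) (Greedy n C K m) L)

  GreedyList-++ : ∀ n C K {L L′} →
                  GreedyList n C K L → GreedyList n C K L′ → GreedyList n C K (L ++ L′)
  GreedyList-++ n C K {L} (L⊆K , f) (L′⊆K , f′) =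
    All.++⁺ L⊆K L′⊆K , λ m → FirstIn-++ L (f m) (f′ m)

  module Cover (P : List X → Set) (P-[] : P []) (P-++ : ∀ {L L′} → P L → P L′ → P (L ++ L′))
               (K C : Pred X 0ℓ) (closed : Closed C)
               (list : ∀ {z} → z ∈ K ∩ C → ∃[ L ] z ∈ˡ L × P L) where

    -- In `greedyList`, `P` is the property of being greedy for the remaining sets inside `K ∩ C 0`;
    -- `P-++` lets the lists through finitely many points be joined.
    coverBelow : ∀ M → ∃[ L ] P L × (∀ m → m < M → W m ≬ (K ∩ C) → Any (_∈ W m) L)
    coverBelow zero    = [] , P-[] , λ _ ()
    coverBelow (suc M) with L , PL , covers ← coverBelow M | em {P = W M ≬ (K ∩ C)}
    ... | no ¬W≬ = L , PL , λ m m<1+M W≬ → covers m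
      (ℕ.≤∧≢⇒< (s≤s⁻¹ m<1+M) λ { refl → ¬W≬ W≬ }) W≬
    ... | yes (z , z∈W , z∈K∩C) with L′ , z∈L′ , PL′ ← list z∈K∩C =
      L′ ++ L , P-++ PL′ PL , λ m m<1+M → covers′ (ℕ.m<1+n⇒m<n∨m≡n m<1+M)
      where
      covers′ : ∀ {m} → m < M ⊎ m ≡ M → W m ≬ (K ∩ C) → Any (_∈ W m) (L′ ++ L)
      covers′ (inj₁ m<M)  W≬ = Any.++⁺ʳ L′ (covers _ m<M W≬)
      covers′ (inj₂ refl) _  = Any.++⁺ˡ (Any.map (λ { refl → z∈W }) z∈L′)

    -- Goodness enters here: a point outside C has only finitely many
    -- neighbourhoods W m meeting C.
    coverNeighbours : ∀ {y} → y ∈ K →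
      ∃[ L ] P L × (∀ m → y ∈ W m → W m ≬ (K ∩ C) → Any (_∈ W m) L)
    coverNeighbours {y} y∈K with em {P = y ∈ C}
    ... | yes y∈C with L , y∈L , PL ← list (y∈K , y∈C) =
      L , PL , λ m y∈W _ → Any.map (λ { refl → y∈W }) y∈L
    ... | no  y∉C with M , W⊆∁C ← proj₂ good closed y∉C
                  with L , PL , covers ← coverBelow M =
      L , PL , λ m y∈W W≬@(z , z∈W , _ , z∈C) →
        covers m (ℕ.≰⇒> λ M≤m → W⊆∁C m M≤m y∈W z∈W z∈C) W≬

    coverAllNeighbours : ∀ {L₀} → All (_∈ K) L₀ →
      ∃[ L ] P L × (∀ m → Any (_∈ W m) L₀ → W m ≬ (K ∩ C) → Any (_∈ W m) L)
    coverAllNeighbours []          = [] , P-[] , λ _ ()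
    coverAllNeighbours (y∈K ∷ L₀⊆K)
      with L , PL , covers ← coverNeighbours y∈K
         | L′ , PL′ , covers′ ← coverAllNeighbours L₀⊆K =
      L ++ L′ , P-++ PL PL′ , λ
        { m (here y∈W)   W≬ → Any.++⁺ˡ (covers m y∈W W≬)
        ; m (there L₀≬W) W≬ → Any.++⁺ʳ L (covers′ m L₀≬W W≬) }

  greedyList : ∀ n C K → (∀ i → Closed (C i)) → ∀ {z} → z ∈ K → ∃[ L ] z ∈ˡ L × GreedyList n C K L
  greedyList zero    C K closed {z} z∈K =
    [ z ] , here refl , z∈K ∷ [] , λ m → (λ _ → z∈K) , λ _ → tt
  greedyList (suc n) C K closed z∈K
    with L , z∈L , L⊆K , firstIn ← greedyList n (C ∘ suc) K (closed ∘ suc) z∈K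
    with L′ , (L′⊆K∩C , firstIn′) , covers ←
      Cover.coverAllNeighbours (GreedyList n (C ∘ suc) (K ∩ C 0)) ([] , λ _ → tt)
        (GreedyList-++ n (C ∘ suc) (K ∩ C 0)) K (C 0) (closed 0)
        (greedyList n (C ∘ suc) (K ∩ C 0) (closed ∘ suc)) L⊆K =
    L′ ++ L , Any.++⁺ʳ L′ z∈L , All.++⁺ (All.map proj₁ L′⊆K∩C) L⊆K , firstIn-++
    where
    firstIn-++ : ∀ m → FirstIn (W m) (Greedy (suc n) C K m) (L′ ++ L)
    firstIn-++ m with em {P = W m ≬ (K ∩ C 0)}
    -- No term of `L′` that counts lies in `W m`, so the choice is left to `L`.
    ... | no ¬W≬ = FirstIn-++ L′
      (FirstIn-map L′ (λ y∈W g → contradiction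
        (_ , y∈W , Greedy⇒∈ n {C ∘ suc} {K ∩ C 0} {m} g) ¬W≬) (firstIn′ m))
      (FirstIn-map L (λ _ g → (λ W≬ → contradiction W≬ ¬W≬) , λ _ → g) (firstIn m))
    ... | yes W≬ with em {P = Any (_∈ W m) L′}
    ... | yes L′≬W = FirstIn-++ˡ L L′≬W
      (FirstIn-map L′ (λ _ g → (λ _ → g) , contradiction W≬) (firstIn′ m))
    -- By `covers`, `L` misses `W m` as well.
    ... | no ¬L′≬W = FirstIn-++ L′ (FirstIn-vacuous L′ ¬L′≬W)
      (FirstIn-vacuous L λ L≬W → ¬L′≬W (covers m L≬W W≬))

-- Existence of the path

module PathExistence {X : Set} (em : ∀ {ℓ} → ExcludedMiddle ℓ) {τ : Topology X}
                     (unif : CountablyUniform τ)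
                     (W : ℕ → Pred X 0ℓ) (basis : Topology.IsBasis τ W)
                     (D : ℕ → X) (dense : Topology.Dense τ (Range D)) (x : X) where
  open Topology τ
  open Classical em
  open TopologyProperties τ
  open UniformTopology em unif

  next : (ℕ → X) → ℕ → X
  next t n with em {P = x ≡ t n} | em {P = ∃[ p ] IsLeast (Candidate W D x t n) p}
  ... | yes _ | _           = t n
  ... | no  _ | yes (p , _) = D p
  -- A default value; `candidate` excludes this case along the path.
  ... | no  _ | no  _       = t n

  next-stay : ∀ t n → x ≡ t n → next t n ≡ t n
  next-stay t n x≡t with em {P = x ≡ t n} | em {P = ∃[ p ] IsLeast (Candidate W D x t n) p}
  ... | yes _  | _ = refl
  ... | no x≢t | _ = contradiction x≡t x≢t

  next-move : ∀ t n → x ≢ t n → ∃[ p ] p ∈ Candidate W D x t n →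
              ∃[ p ] IsLeast (Candidate W D x t n) p × next t n ≡ D p
  next-move t n x≢t (_ , cand)
    with em {P = x ≡ t n} | em {P = ∃[ p ] IsLeast (Candidate W D x t n) p}
  ... | yes x≡t | _               = contradiction x≡t x≢t
  ... | no  _   | yes (p , least) = p , least , refl
  ... | no  _   | no  ¬least      = contradiction (∃-least cand) ¬least

  -- history n is the path cut off after n, as needed for the course-of-values recursion.
  history : ℕ → ℕ → X
  history zero    i = D 0
  history (suc n) i with i ℕ.≤? n
  ... | yes _ = history n i
  ... | no  _ = next (history n) n

  path : ℕ → X
  path n = history n n

  history≗path : ∀ n i → i ≤ n → history n i ≡ path i
  history≗path zero    zero _ = refl
  history≗path (suc n) i i≤1+n with ℕ.m≤n⇒m<n∨m≡n i≤1+n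
  ... | inj₂ refl = refl
  ... | inj₁ i<1+n with i ℕ.≤? n
  ...   | yes i≤n = history≗path n i i≤n
  ...   | no  i≰n = contradiction (s≤s⁻¹ i<1+n) i≰n

  path-suc : ∀ n → path (suc n) ≡ next (history n) n
  path-suc n with suc n ℕ.≤? n
  ... | yes 1+n≤n = contradiction 1+n≤n ℕ.1+n≰n
  ... | no  _     = refl

  Candidate-resp : ∀ {s t n p} → (∀ i → i ≤ n → s i ≡ t i) →
                   Candidate W D x s n p → Candidate W D x t n p
  Candidate-resp s≗t (m , sub , avoid) = m , (λ {y} → sub {y}) , λ y∈W (i , i≤n , y≡ti) →
    avoid y∈W (i , i≤n , trans y≡ti (sym (s≗t i i≤n)))

  path-stay : ∀ n → x ≡ path n → path (suc n) ≡ path n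
  path-stay n x≡s = trans (path-suc n) (next-stay (history n) n x≡s)

  off-Initial : ∀ n → x ≢ path n → ∀ i → i ≤ n → x ≢ path i
  off-Initial zero    x≢s zero _ = x≢s
  off-Initial (suc n) x≢s i i≤1+n with ℕ.m≤n⇒m<n∨m≡n i≤1+n
  ... | inj₂ refl  = x≢s
  ... | inj₁ i<1+n =
    off-Initial n (λ x≡s → x≢s (trans x≡s (sym (path-stay n x≡s)))) i (s≤s⁻¹ i<1+n)

  -- Finitely many points other than x are closed off by a basic neighbourhood of x, in which
  -- density finds a term of `D`.
  candidate : ∀ n → x ≢ path n → ∃[ p ] p ∈ Candidate W D x path n
  candidate n x≢s
    with m , x∈W , W⊆ ← proj₂ basis (Open-∀< (λ i → Closed-singleton (path i)) (suc n))
           (λ i i<1+n s≡x → off-Initial n x≢s i (s≤s⁻¹ i<1+n) (sym s≡x))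
    with _ , (p , refl) , Dp∈W ← dense (proj₁ basis m) (x , x∈W) =
    p , m , (λ { (inj₁ refl) → x∈W ; (inj₂ refl) → Dp∈W })
      , λ y∈W (i , i≤n , y≡s) → W⊆ y∈W i (s≤s i≤n) (sym y≡s)

  isPath : IsPath W D x path
  isPath = record
    { start = refl
    ; stay  = path-stay
    ; move  = λ n x≢s →
        let p , cand = candidate n x≢s
            q , (cq , q≤) , eq = next-move (history n) n x≢s
              (p , Candidate-resp (λ i i≤n → sym (history≗path n i i≤n)) cand)
        in q , ( Candidate-resp (history≗path n) cq
               , λ r cr → q≤ r (Candidate-resp (λ i i≤n → sym (history≗path n i i≤n)) cr))
             , trans (path-suc n) eq
    }

-- Convergence along the path

module Convergence
  (em : ∀ {ℓ} → ExcludedMiddle ℓ) {X Y : Set}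
  (W : ℕ → Pred X 0ℓ) (f : X → Y) (D : ℕ → X) (x : X) (s : ℕ → X) (path : IsPath W D x s) where

  open FirstTerms W D
  open Classical em
  open IsPath path

  stays : ∀ {n} → x ≡ s n → ∀ n′ → n ≤ n′ → x ≡ s n′
  stays x≡s zero     z≤n = x≡s
  stays {n} x≡s (suc n′) n≤1+n′ with ℕ.m≤n⇒m<n∨m≡n n≤1+n′
  ... | inj₂ refl = x≡s
  ... | inj₁ n<1+n′ with x≡s′ ← stays x≡s n′ (s≤s⁻¹ n<1+n′) = trans x≡s′ (sym (stay n′ x≡s′))

  Used : ℕ → ℕ → Set
  Used n m = W m ⊆ ∁ (Initial W D x s n) × s (suc n) ∈ W m

  Used-once : ∀ {n n′ m} → n < n′ → Used n m → ¬ Used n′ m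
  Used-once n<n′ (_ , s∈W) (avoid , _) = avoid s∈W (_ , n<n′ , refl)

  -- Each W m serves at most one step of the path, so m → ∞ along the path.
  converges : ∀ (U : Pred Y 0ℓ) → f x ∈ U →
    ∃[ M ] (∀ m → M ≤ m → x ∈ W m → ∀ p → First m p → f (D p) ∈ U) →
    ∃[ N ] ∀ n → N ≤ n → f (s n) ∈ U
  converges U fx∈U (M , M≤⇒) with em {P = ∃[ n ] x ≡ s n}
  ... | yes (N , x≡s) = N , λ n N≤n → subst (λ y → f y ∈ U) (stays x≡s n N≤n) fx∈U
  ... | no ¬∃ with N , late ← used-once⇒→∞ {T = Used} Used-once M = suc N , tail
    where
    tail : ∀ n → suc N ≤ n → f (s n) ∈ U
    tail (suc n) 1+N≤1+n
      with p , least , s≡D ← move n (¬∃ ∘ (n ,_))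
      with m , x∈W , first , avoid ← Move⇒First (least , s≡D) =
      subst (λ y → f y ∈ U) (sym s≡D) (M≤⇒ m
        (late n (s≤s⁻¹ 1+N≤1+n) m ((λ {y} → avoid {y}) , subst (_∈ W m) (sym s≡D) (proj₁ first)))
        x∈W p first)

-- A countable basis of balls

module CountableBasis (em : ∀ {ℓ} → ExcludedMiddle ℓ) {Y : Set} {τ : Topology Y}
                      (unif : CountablyUniform τ) (sep : Separable τ) where
  open Topology τ
  open CountablyUniform unif
  open UniformTopology em unif

  private
    A       = proj₁ sep
    code    = proj₁ (proj₁ (proj₂ sep))
    code-inj = proj₂ (proj₁ (proj₂ sep))
    dense   = proj₂ (proj₂ sep)

  -- Centres are given by their codes, so that the balls are indexed by numbers; the ball is empty
  -- if n codes no point of `A`.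
  Ball : ℕ → ℕ → Pred Y 0ℓ
  Ball n k y = Σ[ a ∈ Y ] (a ∈ A × code a ≡ n) × E k a y

  Ball-open : ∀ n k → Open (Ball n k)
  Ball-open n k = Open-resp
    ( (λ ((a , a∈A , c) , Eay) → a , (a∈A , c) , Eay)
    , λ (a , (a∈A , c) , Eay) → (a , a∈A , c) , Eay)
    (Open-⋃ {I = Σ[ a ∈ Y ] a ∈ A × code a ≡ n} (λ (a , _) → Open-E k a))

  Ball-basis : ∀ {U} → Open U → ∀ {y} → y ∈ U → ∃[ n ] ∃[ k ] y ∈ Ball n k × Ball n k ⊆ U
  Ball-basis oU {y} y∈U
    with k , E⊆U ← Open⇒E oU y∈U
    with l , E∘E⊆E ← E-halving k
    with a , a∈A , Eya ← dense (Open-E l y) (y , E-refl l y) =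
    code a , l , (a , (a∈A , refl) , E-sym l Eya) , λ (b , (b∈A , eq) , Ebz) →
      E⊆U (E∘E⊆E Eya (subst (λ c → E l c _) (code-inj b∈A a∈A eq) Ebz))

-- Baire class one functions are recoverable

module BaireToRecoverable
  (em : ∀ {ℓ} → ExcludedMiddle ℓ) {X Y : Set} {τX : Topology X} {τY : Topology Y}
  (unifX : CountablyUniform τX) (unifY : CountablyUniform τY) (sepY : Separable τY)
  (x₀ : X) (W : ℕ → Pred X 0ℓ) (good : Topology.IsGoodBasis τX W)
  (f : X → Y) (baire : BaireClassOne τX τY f) where

  open Topology τX
  open Classical em
  open TopologyProperties τX
  open UniformTopology em unifX
  open GreedyLists em {τ = τX} W good
  open CountableBasis em unifY sepY using (Ball; Ball-open; Ball-basis)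

  C : ℕ → Pred X 0ℓ
  C i = let n , r = unpair i ; k , j = unpair r in proj₁ (baire (Ball-open n k)) j

  C-closed : ∀ i → Closed (C i)
  C-closed i = let n , r = unpair i ; k , j = unpair r in proj₁ (proj₂ (baire (Ball-open n k))) j

  C-network : ∀ {U} → Topology.Open τY U → ∀ {x} → f x ∈ U → ∃[ i ] x ∈ C i × C i ⊆ (f ⊢ U)
  C-network {U} oU {x} fx∈U
    with n , k , fx∈B , B⊆U ← Ball-basis oU fx∈U
    with j , x∈ ← proj₁ (proj₂ (proj₂ (baire (Ball-open n k)))) fx∈B
    with r , r↦ ← unpair-surjective k j
    with i , i↦ ← unpair-surjective n r =
    i , subst (λ A → x ∈ A) (sym C≡) x∈
      , λ {y} y∈C → B⊆U (proj₂ (proj₂ (proj₂ (baire (Ball-open n k))))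
          (j , subst (λ A → y ∈ A) C≡ y∈C))
    where
    C≡ : C i ≡ proj₁ (baire (Ball-open n k)) j
    C≡ rewrite i↦ | r↦ = refl

  -- Placing this point in the N-th list makes `D` dense. For empty `W N` the point x₀ keeps the
  -- list nonempty.
  seed : ℕ → X
  seed N with em {P = Satisfiable (W N)}
  ... | yes (x , _) = x
  ... | no  _       = x₀

  seed-∈ : ∀ {N} → Satisfiable (W N) → seed N ∈ W N
  seed-∈ {N} nonempty with em {P = Satisfiable (W N)}
  ... | yes (_ , x∈W) = x∈W
  ... | no  empty     = contradiction nonempty empty

  blocks : ∀ N → Σ[ (y , ys) ∈ X × List X ] seed N ∈ˡ y ∷ ys × GreedyList N C Full (y ∷ ys)
  blocks N with greedyList N C Full C-closed {seed N} _
  ... | y ∷ ys , seed∈ , greedy = (y , ys) , seed∈ , greedy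

  open Concatenation (proj₁ ∘ proj₁ ∘ blocks) (proj₂ ∘ proj₁ ∘ blocks)
    using (block; block-unbounded; ∈block⇒∈Range; first-term) renaming (term to D)
  open FirstTerms W D

  D-dense : Dense (Range D)
  D-dense oU (x , x∈U) with m , x∈W , W⊆U ← proj₂ (proj₁ good) oU x∈U =
    seed m , ∈block⇒∈Range {m} (proj₁ (proj₂ (blocks m))) , W⊆U (seed-∈ (x , x∈W))

  First⇒Greedy : ∀ {m p} → First m p → D p ∈ Greedy (block p) C Full m
  First⇒Greedy {m} {p} (Dp∈W , least) = first-term {G = λ N → Greedy N C Full m}
    (λ N → proj₂ (proj₂ (proj₂ (blocks N))) m) p
    (λ q q<p Dq∈W → ℕ.<⇒≱ q<p (least q Dq∈W)) Dp∈W

  -- For each i the condition on y that it avoid `A i` if x does is open, so goodness applies to the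
  -- finite intersection over i < n.
  avoids : ∀ {A : ℕ → Pred X 0ℓ} → (∀ i → Closed (A i)) → ∀ x n →
           ∃[ M ] ∀ m → M ≤ m → x ∈ W m → ∀ i → i < n → x ∉ A i → W m ⊆ ∁ (A i)
  avoids {A} closed x n =
    let M , M≤⇒ = proj₂ good (Open-∀< open-unless n) (λ _ _ x∉A → x∉A)
    in M , λ m M≤m x∈W i i<n x∉A y∈W → M≤⇒ m M≤m x∈W y∈W i i<n x∉A
    where
    open-unless : ∀ i → Open (λ y → x ∉ A i → y ∉ A i)
    open-unless i with em {P = x ∈ A i}
    ... | yes x∈A = Open-resp ((λ _ x∉A → contradiction x∈A x∉A) , _) Open-Full
    ... | no  x∉A = Open-resp ((λ y∉A _ → y∉A) , λ h → h x∉A) (closed i)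

  First-converges : ∀ {U} → Topology.Open τY U → ∀ {x} → f x ∈ U →
    ∃[ M ] ∀ m → M ≤ m → x ∈ W m → ∀ p → First m p → f (D p) ∈ U
  First-converges {U} oU {x} fx∈U with em {P = x ∈ Range D}
  -- For large m, `W m` contains no `D i` with i ≤ q other than x, while its first term has index at
  -- most q; so that term is x.
  ... | yes (q , x≡Dq) with M , avoid ← avoids (λ i → Closed-singleton (D i)) x (suc q) =
    M , λ m M≤m x∈W p (Dp∈W , least) →
      subst (λ y → f y ∈ U) (sym (decidable-stable em λ Dp≢x →
        avoid m M≤m x∈W p (s≤s (least q (subst (_∈ W m) x≡Dq x∈W))) Dp≢x Dp∈W refl)) fx∈U
  -- For large m, `W m` contains none of the terms before p₀, so its first term lies in a list long
  -- enough for the greedy rule to reach C i.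
  ... | no x∉D
    with i , x∈C , C⊆ ← C-network oU fx∈U
    with p₀ , late ← block-unbounded (suc i)
    with M , avoidD ← avoids (λ i → Closed-singleton (D i)) x p₀
       | M′ , avoidC ← avoids C-closed x i =
    M ⊔ M′ , λ m M⊔M′≤m x∈W p first →
      let p₀≤p = ℕ.≮⇒≥ λ p<p₀ → avoidD m (ℕ.m⊔n≤o⇒m≤o M M′ M⊔M′≤m) x∈W p p<p₀
                   (λ Dp≡x → x∉D (p , sym Dp≡x)) (proj₁ first) refl
      in C⊆ (Greedy⇒∈C (block p) (late p p₀≤p) x∈W _ x∈C
               (avoidC m (ℕ.m⊔n≤o⇒n≤o M M′ M⊔M′≤m) x∈W) (First⇒Greedy first))

  recoverable : Recoverable τX τY W f
  recoverable = D , D-dense , λ x →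
    let open PathExistence em unifX W (proj₁ good) D D-dense x in
    path , isPath , λ {U} oU fx∈U →
      Convergence.converges em W f D x path isPath U fx∈U (First-converges oU fx∈U)

theorem4 : (∀ {ℓ} → ExcludedMiddle ℓ) →
    {X Y : Set} (τX : Topology X) (τY : Topology Y) →
    Separable τX → Metrizable τX →
    Separable τY → Metrizable τY →
    X →
    (W : ℕ → Pred X 0ℓ) → Topology.IsGoodBasis τX W →
    (f : X → Y) →
    Recoverable τX τY W f ⇔ BaireClassOne τX τY f
theorem4 em τX τY _ metrizableX separableY metrizableY x₀ W good f = mk⇔
  (λ (D , _ , recoverable) →
    RecoverableToBaire.baireClassOne em unifX unifY W (proj₁ good) f D recoverable)
  (BaireToRecoverable.recoverable em unifX unifY separableY x₀ W good f)
  where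
  unifX : CountablyUniform τX
  unifX = Classical.metrizable⇒uniform em metrizableX

  unifY : CountablyUniform τY
  unifY = Classical.metrizable⇒uniform em metrizableY
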